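{- For all Conway's games $x,y$, $$x\approx y\iff x\sim y .$$
   Context: Hypergames: work in a universe of possibly non-wellfounded sets (set theory with the Antifoundation Axiom, and the Axiom of Choice). The class $\mathcal H$ of hypergames (also called games) is the carrier of the final coalgebra $(\mathcal H,\mathrm{id})$ of the functor $F(A)=\mathcal P(A)\times\mathcal P(A)$ on the category of classes and functional classes, where $\mathcal P$ is the powerset functor. Thus a hypergame is a pair $x=(X^L,X^R)$ of sets of hypergames; elements $x^L\in X^L$ and $x^R\in X^R$ are the Left and Right options of $x$. Positions of $x$ are the hypergames hereditarily reachable from $x$. $0=(\emptyset,\emptyset)$. Conway's games are the well-founded hypergames, i.e. the elements of the carrier $\mathcal G$ of the initial algebra of $F$: inductively, if $X,X'\subseteq\mathcal G$ are sets then $(X,X')\in\mathcal G$. On Conway's games, define by induction $x\gtrsim y$ iff for all $x^R\in X^R$, $y\not\gtrsim x^R$, and for all $y^L\in Y^L$, $y^L\not\gtrsim x$. Define $x\sim y$ iff $x\gtrsim y$ and $y\gtrsim x$. Sum (on hypergames, defined coinductively): $x+y=(\{x^L+y\mid x^L\in X^L\}\cup\{x+y^L\mid y^L\in Y^L\},\ \{x^R+y\mid x^R\in X^R\}\cup\{x+y^R\mid y^R\in Y^R\})$. Plays: L (Left) and R (Right) move alternately; either may start. Player I is the one who starts, player II the other one; LI means L acting as player I, and similarly LII, RI, RII. A play on $x$ is a (possibly empty) finite or infinite sequence $x_1^{K_1}x_2^{K_2}\cdots$ with $K_i\in\{L,R\}$ and $K_{i+1}\neq K_i$, such that, with $x_0=x$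 and $x_i=(X_i^L,X_i^R)$, one has $x_{i+1}\in X_i^{K_{i+1}}$ for all $i\ge 0$. A finite play is winning for L (resp. R) if it ends with a position $y=(Y^L,Y^R)$ where R (resp. L) is next to move but $Y^R=\emptyset$ (resp. $Y^L=\emptyset$); the empty play ends at $x$ with the starting player next to move. Every infinite play is a draw. A play is non-losing for L (resp. R) if it is winning for L (resp. R) or is a draw. Strategies: for P in $\{$LI, LII, RI, RII$\}$ let $\mathrm{FPlay}^P_x$ be the set of finite plays on $x$ in which P has the prescribed role (first or second player) and is next to move (the empty play is included exactly when P is LI or RI). A strategy for P on $x$ is a partial function $f$ from $\mathrm{FPlay}^P_x$ to positions of $x$ such that $f(\pi)=x'$ implies that $\pi x'$ is a play, and $f(\pi)$ is defined whenever some $\pi x'$ is a play. The opponent of LI is RII, and of LII is RI (and conversely). A play $\pi$ is coherent with $f$ if for each proper prefix $\pi'$ of $\pi$ where P is next to move, $f(\pi')=x'$ implies $\pi'x'$ is a prefix of $\pi$. For a strategy $f$ for P and a strategy $f'$ for the opponent, $f*f'$ is the unique maximal play coherent with both. $f$ is non-losing for P if $f*f'$ is non-losing for P (i.e. for L or R accordingly) for every strategy $f'$ of the opponent. A strategy for L is a pair of strategies for LI and LII; for R, for RI and RII; for I, for LI and RI; for II, for LII and RII. Such a pair is non-losing if both components are. Equideterminacy: $x\Updownarrow y$ iff, for each player P in $\{$L, R, I, II$\}$, $x$ has a non-losing strategy for P if and only if $y$ does. Contextual equivalence: additive contexts are $C[\ ]::=[\ ]\mid C[\ ]+z\mid z+C[\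 ]$ with $z$ any hypergame; $x\approx y$ iff $C[x]\Updownarrow C[y]$ for every additive context $C[\ ]$. -}

module Defs where

open import Data.List.Base using (List; []; _∷_; [_]; _++_; length; applyUpTo)
open import Data.List.Relation.Binary.Pointwise.Base using (Pointwise)
open import Data.List.Relation.Binary.Prefix.Heterogeneous using (Prefix)
open import Data.Maybe using (Maybe; just; Is-just)
import Data.Maybe.Relation.Binary.Pointwise as Maybe
open import Data.Nat.Base using (ℕ; zero; suc)
open import Data.Product.Base using (Σ-syntax; ∃-syntax; _×_; _,_; proj₁; proj₂)
open import Data.Sum.Base using (_⊎_)
open import Function.Bundles using (_⇔_)
open import Induction.WellFounded using (Acc; acc)
open import Level using (Level; _⊔_) renaming (suc to lsuc)
open import Relation.Binary.Bundles using (Setoid)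
open import Relation.Binary.Core using (REL)
open import Relation.Binary.PropositionalEquality.Core using (_≡_)
open import Relation.Nullary.Negation.Core using (¬_)
open import Relation.Unary using (Pred; _∈_)

private variable
  ℓ : Level

-- Set-theoretic choice: every partition has a system of representatives.
-- The `≡` is essential: related elements get the *same* representative, which
-- the choice provable in type theory does not give.
Choice : ∀ a r → Set (lsuc (a ⊔ r))
Choice a r = (S : Setoid a r) → let open Setoid S in
  Σ[ rep ∈ (Carrier → Carrier) ]
    (∀ u → rep u ≈ u) × (∀ {u v} → u ≈ v → rep u ≡ rep v)

data Player : Set where
  L R : Player

opp : Player → Player
opp L = R
opp R = L

-- "Set" is read as "type in Set ℓ" and "class" as "type in Set (lsuc ℓ)".
-- The final coalgebra of F(A) = 𝒫(A) × 𝒫(A) is presented as the pointed small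
-- F-coalgebras, taken up to bisimilarity `_≅_`: under antifoundation each of
-- them depicts exactly one hypergame, every hypergame is so depicted (by its
-- own positions), and two depict the same one iff they are bisimilar. Hence
-- `_≅_` is the equality of hypergames, used as such everywhere below.
record Hypergame ℓ : Set (lsuc ℓ) where
  field
    Pos     : Set ℓ
    options : Pos → Player → Pred Pos ℓ
    root    : Pos

open Hypergame public

_at_ : (x : Hypergame ℓ) → Pos x → Hypergame ℓ
x at p = record { Pos = Pos x ; options = options x ; root = p }

infix 4 _≅_ _∈[_]_

record _≅_ (x y : Hypergame ℓ) : Set (lsuc ℓ) where
  field
    rel   : REL (Pos x) (Pos y) ℓ
    roots : rel (root x) (root y)
    forth : ∀ {p q} → rel p q → ∀ {K p′} → p′ ∈ options x p K →
            ∃[ q′ ] q′ ∈ options y q K × rel p′ q′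
    back  : ∀ {p q} → rel p q → ∀ {K q′} → q′ ∈ options y q K →
            ∃[ p′ ] p′ ∈ options x p K × rel p′ q′

-- y ∈ X^K, where x = (X^L , X^R).
_∈[_]_ : Hypergame ℓ → Player → Hypergame ℓ → Set (lsuc ℓ)
y ∈[ K ] x = ∃[ p ] p ∈ options x (root x) K × y ≅ (x at p)

-- Since (x + y) at (p , q) is (x at p) + (y at q), the options of x + y are
-- the x^K + y and the x + y^K.
infixl 6 _+_
_+_ : Hypergame ℓ → Hypergame ℓ → Hypergame ℓ
x + y = record
  { Pos     = Pos x × Pos y
  ; options = λ (p , q) K (p′ , q′) →
      (p′ ∈ options x p K × q′ ≡ q) ⊎ (p′ ≡ p × q′ ∈ options y q K)
  ; root    = root x , root y
  }

_isOptionOf_ : Hypergame ℓ → Hypergame ℓ → Set (lsuc ℓ)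
y isOptionOf x = ∃[ K ] y ∈[ K ] x

WellFounded : Hypergame ℓ → Set (lsuc ℓ)
WellFounded = Acc _isOptionOf_

-- Conway's games.
record Game ℓ : Set (lsuc ℓ) where
  field
    hypergame   : Hypergame ℓ
    wellFounded : WellFounded hypergame

open Game public

Gtr : {x y : Hypergame ℓ} → WellFounded x → WellFounded y → Set (lsuc ℓ)
Gtr {x = x} {y = y} wx@(acc rx) wy@(acc ry) =
    (∀ {xᴿ} (m : xᴿ ∈[ R ] x) → ¬ Gtr wy (rx (R , m)))
  × (∀ {yᴸ} (m : yᴸ ∈[ L ] y) → ¬ Gtr (ry (L , m)) wx)

infix 4 _≳_ _∼_

_≳_ : Game ℓ → Game ℓ → Set (lsuc ℓ)
x ≳ y = Gtr (wellFounded x) (wellFounded y)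

_∼_ : Game ℓ → Game ℓ → Set (lsuc ℓ)
x ∼ y = x ≳ y × y ≳ x

-- A play x₁^K₁ x₂^K₂ … is given by its starting player and the sequence
-- x₁ x₂ … ; alternation then determines the labels Kᵢ.
data Sequence ℓ : Set (lsuc ℓ) where
  fin : List (Hypergame ℓ) → Sequence ℓ
  inf : (ℕ → Hypergame ℓ) → Sequence ℓ

-- mover K n = Kₙ₊₁, the player to move after n moves when K starts.
mover : Player → ℕ → Player
mover K zero    = K
mover K (suc n) = mover (opp K) n

data IsFinitePlay {ℓ} : Player → Hypergame ℓ → List (Hypergame ℓ) → Set (lsuc ℓ) where
  []  : ∀ {K x} → IsFinitePlay K x []
  _∷_ : ∀ {K x y π} → y ∈[ K ] x → IsFinitePlay (opp K) y π →
        IsFinitePlay K x (y ∷ π)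

-- x₀ = x and xᵢ₊₁ = s i.
position : Hypergame ℓ → (ℕ → Hypergame ℓ) → ℕ → Hypergame ℓ
position x s zero    = x
position x s (suc i) = s i

IsPlay : Player → Hypergame ℓ → Sequence ℓ → Set (lsuc ℓ)
IsPlay K x (fin π) = IsFinitePlay K x π
IsPlay K x (inf s) = ∀ i → s i ∈[ mover K i ] position x s i

final : Hypergame ℓ → List (Hypergame ℓ) → Hypergame ℓ
final x []      = x
final x (y ∷ π) = final y π

-- The arguments are: the player A concerned, the starting player K, and the
-- hypergame x played on.
data Winning {ℓ} (A K : Player) (x : Hypergame ℓ) : Sequence ℓ → Set (lsuc ℓ) where
  stuck : ∀ {π} → mover K (length π) ≡ opp A →
          (∀ y → ¬ y ∈[ opp A ] final x π) → Winning A K x (fin π)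

data Draw {ℓ} : Sequence ℓ → Set (lsuc ℓ) where
  infinite : ∀ {s} → Draw (inf s)

NonLosing : Player → Player → Hypergame ℓ → Sequence ℓ → Set (lsuc ℓ)
NonLosing A K x q = Winning A K x q ⊎ Draw q

infix 4 _⊑_ _⊏_

data _⊑_ {ℓ} : Sequence ℓ → Sequence ℓ → Set (lsuc ℓ) where
  fin-fin : ∀ {π ρ} → Prefix _≅_ π ρ → fin π ⊑ fin ρ
  fin-inf : ∀ {π s} → Pointwise _≅_ π (applyUpTo s (length π)) → fin π ⊑ inf s
  inf-inf : ∀ {s t} → (∀ i → s i ≅ t i) → inf s ⊑ inf t

_⊏_ : Sequence ℓ → Sequence ℓ → Set (lsuc ℓ)
q ⊏ r = q ⊑ r × ¬ r ⊑ q

data Role : Set where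
  LI LII RI RII : Role

player starter : Role → Player

player LI  = L
player LII = L
player RI  = R
player RII = R

starter LI  = L
starter LII = R
starter RI  = R
starter RII = L

opponent : Role → Role
opponent LI  = RII
opponent LII = RI
opponent RI  = LII
opponent RII = LI

record FPlay (P : Role) (x : Hypergame ℓ) : Set (lsuc ℓ) where
  field
    moves  : List (Hypergame ℓ)
    isPlay : IsFinitePlay (starter P) x moves
    toMove : mover (starter P) (length moves) ≡ player P

open FPlay public

-- `next-cong` makes the strategy a function of the play as a sequence of
-- hypergames, i.e. up to `_≅_`.
record Strategy (P : Role) (x : Hypergame ℓ) : Set (lsuc ℓ) where
  field
    next      : FPlay P x → Maybe (Hypergame ℓ)
    next-cong : ∀ {π ρ} → Pointwise _≅_ (moves π) (moves ρ) →
                Maybe.Pointwise _≅_ (next π) (next ρ)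
    legal     : ∀ π {y} → next π ≡ just y →
                IsFinitePlay (starter P) x (moves π ++ [ y ])
    total     : ∀ π {y} → IsFinitePlay (starter P) x (moves π ++ [ y ]) →
                Is-just (next π)

open Strategy public

Coherent : ∀ {P} {x : Hypergame ℓ} → Strategy P x → Sequence ℓ → Set (lsuc ℓ)
Coherent f q = ∀ π → fin (moves π) ⊏ q →
               ∀ {y} → next f π ≡ just y → fin (moves π ++ [ y ]) ⊑ q

-- q is f * f′, the unique maximal play coherent with both strategies.
record Outcome {P} {x : Hypergame ℓ} (f : Strategy P x)
               (f′ : Strategy (opponent P) x) (q : Sequence ℓ) : Set (lsuc ℓ) where
  field
    play      : IsPlay (starter P) x q
    coherent  : Coherent f q
    coherent′ : Coherent f′ q
    maximal   : ∀ r → IsPlay (starter P) x r → Coherent f r → Coherent f′ r →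
                q ⊑ r → r ⊑ q

IsNonLosing : ∀ {P} {x : Hypergame ℓ} → Strategy P x → Set (lsuc ℓ)
IsNonLosing {P = P} {x = x} f =
  ∀ f′ q → Outcome f f′ q → NonLosing (player P) (starter P) x q

data Side : Set where
  L R I II : Side

roles : Side → Role × Role
roles L  = LI  , LII
roles R  = RI  , RII
roles I  = LI  , RI
roles II = LII , RII

SideStrategy : Side → Hypergame ℓ → Set (lsuc ℓ)
SideStrategy S x = Strategy (proj₁ (roles S)) x × Strategy (proj₂ (roles S)) x

HasNonLosing : Side → Hypergame ℓ → Set (lsuc ℓ)
HasNonLosing S x = Σ[ (f , g) ∈ SideStrategy S x ] IsNonLosing f × IsNonLosing g

infix 4 _⇕_ _≈_

_⇕_ : Hypergame ℓ → Hypergame ℓ → Set (lsuc ℓ)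
x ⇕ y = ∀ S → HasNonLosing S x ⇔ HasNonLosing S y

data Context ℓ : Set (lsuc ℓ) where
  □    : Context ℓ
  _+ʳ_ : Context ℓ → Hypergame ℓ → Context ℓ
  _+ˡ_ : Hypergame ℓ → Context ℓ → Context ℓ

plug : Context ℓ → Hypergame ℓ → Hypergame ℓ
plug □        x = x
plug (C +ʳ z) x = plug C x + z
plug (z +ˡ C) x = z + plug C x

_≈_ : Hypergame ℓ → Hypergame ℓ → Set (lsuc ℓ)
x ≈ y = ∀ C → plug C x ⇕ plug C y

{-# OPTIONS --safe #-}
module Submission where

-- Everything is phrased with non-losing regions. A region for the player A is
-- a class S of hypergames such that to every move of the opponent from a
-- member of S, A has a reply that leads back into S. A hypergame with the
-- opponent to move is "safe" for A if it lies in a region for A; with A to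
-- move, if A can move into one.
--
-- A role has a non-losing strategy on x iff x is safe for its player
-- (`nonLosing⇒safe`, `safe⇒nonLosing`). Given a non-losing strategy f, the
-- positions reached by plays coherent with f form a region: if f had no answer
-- after such a play, then an opponent who aims at that very play would make it
-- the outcome, and it is lost. Conversely, on a safe hypergame a strategy that
-- moves into S whenever it can is never stuck. Both strategies, that of the opponent and
-- that of the region, are instances of one construction, which aims at a goal
-- depending only on the time and on the position. A strategy must treat equal
-- positions alike, so its choices are made at canonical representatives: this
-- is where choice is needed.
--
-- For the implication from ∼ to ≈: an additive context is the addition of one
-- summand z (`plug-≅`), so it suffices that if x is at least as good as y for
-- A and y + z is safe for A, then x + z is safe for A (`Safe-improve`). A
-- plays on x + z while imagining a play on y + z. That x is at least as good
-- as y tells A how to go on when the real opponent moves in x or when the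
-- imagined A moves in y: either A has a real move in x, or the opponent has
-- an imagined move in y, after which x is still at least as good. Since y is
-- well-founded, only finitely many moves are imagined before a real one.
--
-- For the converse, the copycat strategy is non-losing for the second player
-- on x - x (`Safe-copycat`). By x ≈ y, the second player, whether Left or
-- Right, has a non-losing strategy on y - x. Safety on a difference of
-- well-founded games implies the order (`difference-better`), and the two
-- cases give y ≳ x and x ≳ y.

open import Defs
open import Axiom.ExcludedMiddle using (ExcludedMiddle)
open import Data.Empty using (⊥-elim)
open import Data.Empty.Polymorphic using (⊥)
open import Data.List.Base using (List; []; _∷_; [_]; _++_; length; applyUpTo)
open import Data.List.Properties using (applyUpTo-∷ʳ)
open import Data.List.Relation.Binary.Pointwise as Pointwise
  using (Pointwise; []; _∷_; Pointwise-length)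
open import Data.List.Relation.Binary.Prefix.Heterogeneous using (Prefix; []; _∷_)
import Data.List.Relation.Binary.Prefix.Heterogeneous.Properties as Prefix
open import Data.List.Reverse using (Reverse; []; _∶_∶ʳ_; reverseView)
open import Data.Maybe using (Maybe; just; nothing; Is-just)
import Data.Maybe.Relation.Binary.Pointwise as Maybe
open import Data.Maybe.Relation.Unary.Any using (just)
open import Data.Nat.Base as ℕ using (ℕ; zero)
open import Data.Nat.Properties using (1+n≰n; ≤-trans; ≤-reflexive; suc-injective)
open import Data.Product.Base using (Σ-syntax; ∃-syntax; _×_; _,_; proj₁; proj₂)
open import Data.Sum.Base using (_⊎_; inj₁; inj₂)
open import Data.Unit.Polymorphic.Base using (⊤)
open import Function.Bundles using (_⇔_; mk⇔; Equivalence)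
open import Induction.WellFounded using (acc)
open import Level using (Level; suc)
open import Relation.Binary.Bundles using (Setoid)
open import Relation.Binary.PropositionalEquality
  using (_≡_; refl; sym; trans; cong; cong₂; subst; subst₂)
open import Relation.Nullary.Decidable.Core using (Dec; yes; no; decidable-stable)
open import Relation.Nullary.Negation.Core using (¬_; contradiction)
open import Relation.Unary using (Pred; _∈_)

private variable
  ℓ : Level
  x y z u v w : Hypergame ℓ
  A K : Player
  π ρ σ : List (Hypergame ℓ)

-- Players and roles

opp-involutive : ∀ K → opp (opp K) ≡ K
opp-involutive L = refl
opp-involutive R = refl

opp-irreflexive : ∀ K → ¬ K ≡ opp K
opp-irreflexive L ()
opp-irreflexive R ()

same-or-opp : ∀ K A → K ≡ A ⊎ K ≡ opp A
same-or-opp L L = inj₁ refl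
same-or-opp L R = inj₂ refl
same-or-opp R L = inj₂ refl
same-or-opp R R = inj₁ refl

mover-suc : ∀ K n → mover K (ℕ.suc n) ≡ opp (mover K n)
mover-suc K zero    = refl
mover-suc K (ℕ.suc n) = mover-suc (opp K) n

player-opponent : ∀ P → player (opponent P) ≡ opp (player P)
player-opponent LI  = refl
player-opponent LII = refl
player-opponent RI  = refl
player-opponent RII = refl

starter-opponent : ∀ P → starter (opponent P) ≡ starter P
starter-opponent LI  = refl
starter-opponent LII = refl
starter-opponent RI  = refl
starter-opponent RII = refl

-- Equality of hypergames and membership

open _≅_

≅-refl : x ≅ x
≅-refl = record
  { rel   = _≡_
  ; roots = refl
  ; forth = λ { refl m → _ , m , refl }
  ; back  = λ { refl m → _ , m , refl }
  }

≅-sym : x ≅ y → y ≅ x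
≅-sym e = record
  { rel   = λ q p → rel e p q
  ; roots = roots e
  ; forth = back e
  ; back  = forth e
  }

≅-trans : x ≅ y → y ≅ z → x ≅ z
≅-trans e f = record
  { rel   = λ p r → ∃[ q ] rel e p q × rel f q r
  ; roots = _ , roots e , roots f
  ; forth = λ (_ , a , b) m →
      let _ , m′ , a′ = forth e a m
          _ , m″ , b′ = forth f b m′
      in  _ , m″ , _ , a′ , b′
  ; back  = λ (_ , a , b) m →
      let _ , m′ , b′ = back f b m
          _ , m″ , a′ = back e a m′
      in  _ , m″ , _ , a′ , b′
  }

at-cong : (e : x ≅ y) → ∀ {p q} → rel e p q → (x at p) ≅ (y at q)
at-cong e a = record { rel = rel e ; roots = a ; forth = forth e ; back = back e }

∈-respˡ : y ≅ z → z ∈[ K ] x → y ∈[ K ] x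
∈-respˡ e (p , m , f) = p , m , ≅-trans e f

∈-respʳ : x ≅ y → z ∈[ K ] x → z ∈[ K ] y
∈-respʳ e (p , m , f) =
  let q , m′ , a = forth e (roots e) m in q , m′ , ≅-trans f (at-cong e a)

-- Sums and negation

+-cong : x ≅ y → u ≅ v → x + u ≅ y + v
+-cong e f = record
  { rel   = λ (p , r) (q , s) → rel e p q × rel f r s
  ; roots = roots e , roots f
  ; forth = λ where
      (a , b) (inj₁ (m , refl)) →
        let _ , m′ , a′ = forth e a m in _ , inj₁ (m′ , refl) , a′ , b
      (a , b) (inj₂ (refl , m)) →
        let _ , m′ , b′ = forth f b m in _ , inj₂ (refl , m′) , a , b′
  ; back  = λ where
      (a , b) (inj₁ (m , refl)) →
        let _ , m′ , a′ = back e a m in _ , inj₁ (m′ , refl) , a′ , b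
      (a , b) (inj₂ (refl , m)) →
        let _ , m′ , b′ = back f b m in _ , inj₂ (refl , m′) , a , b′
  }

+-comm : (x y : Hypergame ℓ) → x + y ≅ y + x
+-comm x y = record
  { rel   = λ (p , q) s → s ≡ (q , p)
  ; roots = refl
  ; forth = λ where
      refl (inj₁ (m , refl)) → _ , inj₂ (refl , m) , refl
      refl (inj₂ (refl , m)) → _ , inj₁ (m , refl) , refl
  ; back  = λ where
      refl (inj₁ (m , refl)) → _ , inj₂ (refl , m) , refl
      refl (inj₂ (refl , m)) → _ , inj₁ (m , refl) , refl
  }

+-assoc : (x y z : Hypergame ℓ) → (x + y) + z ≅ x + (y + z)
+-assoc x y z = record
  { rel   = λ ((p , q) , r) s → s ≡ (p , (q , r))
  ; roots = refl
  ; forth = λ where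
      refl (inj₁ (inj₁ (m , refl) , refl)) → _ , inj₁ (m , refl) , refl
      refl (inj₁ (inj₂ (refl , m) , refl)) → _ , inj₂ (refl , inj₁ (m , refl)) , refl
      refl (inj₂ (refl , m))               → _ , inj₂ (refl , inj₂ (refl , m)) , refl
  ; back  = λ where
      refl (inj₁ (m , refl))               → _ , inj₁ (inj₁ (m , refl) , refl) , refl
      refl (inj₂ (refl , inj₁ (m , refl))) → _ , inj₁ (inj₂ (refl , m) , refl) , refl
      refl (inj₂ (refl , inj₂ (refl , m))) → _ , inj₂ (refl , m) , refl
  }

-- The hypergame 0 = (∅ , ∅).
𝟎 : Hypergame ℓ
𝟎 = record { Pos = ⊤ ; options = λ _ _ _ → ⊥ ; root = _ }

+-identityʳ : (x : Hypergame ℓ) → x ≅ x + 𝟎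
+-identityʳ x = record
  { rel   = λ p s → s ≡ (p , _)
  ; roots = refl
  ; forth = λ { refl m → _ , inj₁ (m , refl) , refl }
  ; back  = λ { refl (inj₁ (m , refl)) → _ , m , refl }
  }

+-option⁻ : w ∈[ K ] (x + z) →
            (∃[ x′ ] x′ ∈[ K ] x × w ≅ x′ + z) ⊎ (∃[ z′ ] z′ ∈[ K ] z × w ≅ x + z′)
+-option⁻ {x = x} (_ , inj₁ (m , refl) , e) = inj₁ (x at _ , (_ , m , ≅-refl) , e)
+-option⁻ {z = z} (_ , inj₂ (refl , m) , e) = inj₂ (z at _ , (_ , m , ≅-refl) , e)

+-optionˡ : y ∈[ K ] x → (y + z) ∈[ K ] (x + z)
+-optionˡ (_ , m , e) = _ , inj₁ (m , refl) , +-cong e ≅-refl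

+-optionʳ : y ∈[ K ] z → (x + y) ∈[ K ] (x + z)
+-optionʳ (_ , m , e) = _ , inj₂ (refl , m) , +-cong ≅-refl e

-- Conway's negation: the two players exchange their moves.
neg : Hypergame ℓ → Hypergame ℓ
neg x = record { Pos = Pos x ; options = λ p K → options x p (opp K) ; root = root x }

neg-cong : x ≅ y → neg x ≅ neg y
neg-cong e = record
  { rel   = rel e
  ; roots = roots e
  ; forth = λ a m → forth e a m
  ; back  = λ a m → back e a m
  }

neg-option⁺ : y ∈[ opp K ] x → neg y ∈[ K ] neg x
neg-option⁺ (p , m , e) = p , m , neg-cong e

neg-option⁻ : w ∈[ K ] neg x → ∃[ y ] y ∈[ opp K ] x × w ≅ neg y
neg-option⁻ {x = x} (p , m , e) = x at p , (p , m , ≅-refl) , e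

-- Every additive context is, up to equality, the addition of one summand.
summand : Context ℓ → Hypergame ℓ
summand □        = 𝟎
summand (C +ʳ z) = summand C + z
summand (z +ˡ C) = summand C + z

plug-≅ : ∀ C (x : Hypergame ℓ) → plug C x ≅ x + summand C
plug-≅ □        x = +-identityʳ x
plug-≅ (C +ʳ z) x = ≅-trans (+-cong (plug-≅ C x) ≅-refl) (+-assoc x (summand C) z)
plug-≅ (z +ˡ C) x = ≅-trans (+-comm z (plug C x))
  (≅-trans (+-cong (plug-≅ C x) ≅-refl) (+-assoc x (summand C) z))

-- The order on Conway's games, seen by either player

-- `Better A wx wy`, where wx and wy witness that x and y are well-founded, says
-- that x is at least as good as y for the player A.
Better : Player → {x y : Hypergame ℓ} → WellFounded x → WellFounded y → Set (suc ℓ)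
Better L wx wy = Gtr wx wy
Better R wx wy = Gtr wy wx

module _ {x y : Hypergame ℓ} where

  module _ {rx : ∀ {x′} → x′ isOptionOf x → WellFounded x′}
           {ry : ∀ {y′} → y′ isOptionOf y → WellFounded y′} where

    better⁺ : (∀ {x′} (m : x′ ∈[ opp A ] x) → ¬ Better A (acc ry) (rx (opp A , m))) →
              (∀ {y′} (m : y′ ∈[ A ] y) → ¬ Better A (ry (A , m)) (acc rx)) →
              Better A (acc rx) (acc ry)
    better⁺ {A = L} f g = f , g
    better⁺ {A = R} f g = g , f

    better⁻₁ : Better A (acc rx) (acc ry) →
               ∀ {x′} (m : x′ ∈[ opp A ] x) → ¬ Better A (acc ry) (rx (opp A , m))
    better⁻₁ {A = L} (f , _) = f
    better⁻₁ {A = R} (_ , f) = f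

    better⁻₂ : Better A (acc rx) (acc ry) →
               ∀ {y′} (m : y′ ∈[ A ] y) → ¬ Better A (ry (A , m)) (acc rx)
    better⁻₂ {A = L} (_ , g) = g
    better⁻₂ {A = R} (g , _) = g

    ¬better : ExcludedMiddle (suc ℓ) → ¬ Better A (acc rx) (acc ry) →
              (∃[ x′ ] Σ[ m ∈ x′ ∈[ opp A ] x ] Better A (acc ry) (rx (opp A , m))) ⊎
              (∃[ y′ ] Σ[ m ∈ y′ ∈[ A ] y ] Better A (ry (A , m)) (acc rx))
    ¬better em n = decidable-stable em λ k →
      n (better⁺ (λ m b → k (inj₁ (_ , m , b))) (λ m b → k (inj₂ (_ , m , b))))

-- Non-losing regions

-- A, who is to move, has a move into S.
Reply : Player → Pred (Hypergame ℓ) (suc ℓ) → Pred (Hypergame ℓ) (suc ℓ)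
Reply A S y = ∃[ y′ ] y′ ∈[ A ] y × S y′

-- A non-losing region: its members are regarded with the opponent of A to move,
-- and A can always come back to it. No progress is required, since infinite plays
-- are draws.
record Region (A : Player) (S : Pred (Hypergame ℓ) (suc ℓ)) : Set (suc ℓ) where
  field
    resp  : x ≅ y → S x → S y
    reply : S x → y ∈[ opp A ] x → Reply A S y

open Region

-- The status of x with respect to S when K is to move.
Alive : Player → Pred (Hypergame ℓ) (suc ℓ) → Player → Pred (Hypergame ℓ) (suc ℓ)
Alive A S K x = (K ≡ A → Reply A S x) × (K ≡ opp A → S x)

-- x is safe for A when K starts. The region lives at the level of excluded
-- middle, so that the options in it can be told from the others.
Safe : Player → Player → Hypergame ℓ → Set (suc (suc ℓ))
Safe {ℓ} A K x = Σ[ S ∈ Pred (Hypergame ℓ) (suc ℓ) ] Region A S × Alive A S K x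

Reply-respʳ : {S : Pred (Hypergame ℓ) (suc ℓ)} → x ≅ y → Reply A S x → Reply A S y
Reply-respʳ e (y′ , m , s) = y′ , ∈-respʳ e m , s

Safe-resp : x ≅ y → Safe A K x → Safe A K y
Safe-resp e (S , r , (a , b)) =
  S , r , (λ k → Reply-respʳ e (a k)) , (λ k → resp r e (b k))

-- Replacing a summand by a better one

module Improve (em : ExcludedMiddle (suc ℓ)) {A : Player}
               {S : Pred (Hypergame ℓ) (suc ℓ)} (r : Region A S) where

  -- In w = x + z the opponent is to move, and A imagines y + z instead, where x
  -- is at least as good as y.
  Improved : Pred (Hypergame ℓ) (suc ℓ)
  Improved w = Σ[ x ∈ Hypergame ℓ ] Σ[ y ∈ Hypergame ℓ ] Σ[ z ∈ Hypergame ℓ ]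
               Σ[ wx ∈ WellFounded x ] Σ[ wy ∈ WellFounded y ]
               w ≅ x + z × Better A wx wy × S (y + z)

  -- A can turn an imagined move from y + z into a real one from x + z: a move in
  -- z is copied, and a move to y′ in y leaves x with the opponent to move in
  -- y′ + z, which is the situation of `improve-position`. The two recurse along
  -- the well-foundedness of y.
  improve-reply : (wx : WellFounded x) (wy : WellFounded y) → Better A wx wy →
                  Reply A S (y + z) → Reply A Improved (x + z)
  -- With A really to move in x + z and the opponent in the imagined y + z, where
  -- y is not at least as good as x: either A has a good move in x, or the
  -- opponent has one in y, to be imagined.
  improve-position : (wx : WellFounded x) (wy : WellFounded y) → ¬ Better A wy wx →
                     S (y + z) → Reply A Improved (x + z)

  improve-reply (acc rx) (acc ry) b (_ , m , s) with +-option⁻ m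
  ... | inj₁ (y′ , m′ , e) =
    improve-position (acc rx) (ry (A , m′)) (better⁻₂ {A = A} b m′) (resp r e s)
  ... | inj₂ (z′ , m′ , e) =
    _ , +-optionʳ m′ , _ , _ , z′ , acc rx , acc ry , ≅-refl , b , resp r e s

  improve-position (acc rx) (acc ry) n s with ¬better {A = A} em n
  ... | inj₁ (y′ , m , b) =
    improve-reply (acc rx) (ry (opp A , m)) b (reply r s (+-optionˡ m))
  ... | inj₂ (x′ , m , b) =
    _ , +-optionˡ m , _ , _ , _ , rx (A , m) , acc ry , ≅-refl , b , s

  improved-region : Region A Improved
  improved-region .resp e (x , y , z , wx , wy , f , bs) =
    x , y , z , wx , wy , ≅-trans (≅-sym e) f , bs
  improved-region .reply (x , y , z , acc rx , acc ry , e , b , s) m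
    with +-option⁻ (∈-respʳ e m)
  ... | inj₂ (z′ , m′ , f) = Reply-respʳ (≅-sym f)
    (improve-reply (acc rx) (acc ry) b (reply r s (+-optionʳ m′)))
  ... | inj₁ (x′ , m′ , f) = Reply-respʳ (≅-sym f)
    (improve-position (rx (opp A , m′)) (acc ry) (better⁻₁ {A = A} b m′) s)

Safe-improve : ExcludedMiddle (suc ℓ) → (wx : WellFounded x) (wy : WellFounded y) →
               Better A wx wy → Safe A K (y + z) → Safe {ℓ} A K (x + z)
Safe-improve em wx wy b (S , r , (mine , theirs)) =
  Improved , improved-region ,
  (λ k → improve-reply wx wy b (mine k)) ,
  (λ k → _ , _ , _ , wx , wy , ≅-refl , b , theirs k)
  where open Improve em r

-- Playing on a difference

Safe-copycat : ∀ A (x : Hypergame ℓ) → Safe A (opp A) (x + neg x)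
Safe-copycat {ℓ} A x =
  Copy , region , (λ k → ⊥-elim (opp-irreflexive A (sym k))) , (λ _ → x , ≅-refl)
  where
  Copy : Pred (Hypergame ℓ) (suc ℓ)
  Copy w = ∃[ u ] w ≅ u + neg u

  region : Region A Copy
  region .resp e (u , f) = u , ≅-trans (≅-sym e) f
  region .reply (u , e) m with +-option⁻ (∈-respʳ e m)
  ... | inj₁ (u′ , m′ , f) =
    u′ + neg u′ , ∈-respʳ (≅-sym f) (+-optionʳ (neg-option⁺ m′)) , u′ , ≅-refl
  ... | inj₂ (v , m′ , f) with neg-option⁻ m′
  ... | u′ , m″ , g =
    u′ + neg u′ ,
    ∈-respʳ (≅-sym (≅-trans f (+-cong ≅-refl g)))
            (+-optionˡ (subst (u′ ∈[_] u) (opp-involutive A) m″)) ,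
    u′ , ≅-refl

module _ {S : Pred (Hypergame ℓ) (suc ℓ)} (r : Region A S) where

  -- If A survives x - y as second player, then x is at least as good as y: an
  -- option witnessing the contrary is a move of the opponent, and the reply of A
  -- to it refutes the witness.
  difference-better : (wx : WellFounded x) (wy : WellFounded y) →
                      S (x + neg y) → Better A wx wy
  difference-¬better : (wx : WellFounded x) (wy : WellFounded y) →
                       Reply A S (x + neg y) → ¬ Better A wy wx

  difference-better {y = y} (acc rx) (acc ry) s = better⁺ {A = A}
    (λ m → difference-¬better (rx (opp A , m)) (acc ry) (reply r s (+-optionˡ m)))
    (λ m → difference-¬better (acc rx) (ry (A , m))
      (reply r s (+-optionʳ (neg-option⁺ (subst (_ ∈[_] y) (sym (opp-involutive A)) m)))))

  difference-¬better (acc rx) (acc ry) (_ , m , s) b with +-option⁻ m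
  ... | inj₁ (x′ , m′ , e) = better⁻₂ {A = A} b m′
    (difference-better (rx (A , m′)) (acc ry) (resp r e s))
  ... | inj₂ (v , m′ , e) with neg-option⁻ m′
  ... | y′ , m″ , f = better⁻₁ {A = A} b m″
    (difference-better (acc rx) (ry (opp A , m″))
      (resp r (≅-trans e (+-cong ≅-refl f)) s))

-- Lists of hypergames up to equality

length-∷ʳ : ∀ (π : List (Hypergame ℓ)) {y} → length (π ++ [ y ]) ≡ ℕ.suc (length π)
length-∷ʳ []      = refl
length-∷ʳ (_ ∷ π) = cong ℕ.suc (length-∷ʳ π)

∷ʳ-cong : ∀ (π : List (Hypergame ℓ)) → y ≅ z → Pointwise _≅_ (π ++ [ y ]) (π ++ [ z ])
∷ʳ-cong π e = Pointwise.++⁺ (Pointwise.refl ≅-refl) (e ∷ [])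

prefix-refl : Prefix _≅_ π π
prefix-refl = Prefix.fromPointwise (Pointwise.refl ≅-refl)

prefix-∷ʳ : ∀ (π : List (Hypergame ℓ)) {y} → Prefix _≅_ π (π ++ [ y ])
prefix-∷ʳ []      = []
prefix-∷ʳ (_ ∷ π) = ≅-refl ∷ prefix-∷ʳ π

prefix-trans : Prefix _≅_ ρ σ → Prefix _≅_ σ π → Prefix _≅_ ρ π
prefix-trans = Prefix.trans ≅-trans

∷ʳ-not-prefix : ∀ {π : List (Hypergame ℓ)} {y} → ¬ Prefix _≅_ (π ++ [ y ]) π
∷ʳ-not-prefix {π = π} p =
  1+n≰n (≤-trans (≤-reflexive (sym (length-∷ʳ π))) (Prefix.length-mono p))

prefix-∷ʳ⁻ : ∀ (ρ π : List (Hypergame ℓ)) {y z} → Prefix _≅_ (ρ ++ [ z ]) (π ++ [ y ]) →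
             Prefix _≅_ (ρ ++ [ z ]) π ⊎ Pointwise _≅_ ρ π × z ≅ y
prefix-∷ʳ⁻ []          []      (e ∷ _) = inj₂ ([] , e)
prefix-∷ʳ⁻ []          (_ ∷ _) (e ∷ _) = inj₁ (e ∷ [])
prefix-∷ʳ⁻ (_ ∷ [])    []      (_ ∷ ())
prefix-∷ʳ⁻ (_ ∷ _ ∷ _) []      (_ ∷ ())
prefix-∷ʳ⁻ (_ ∷ ρ)     (_ ∷ π) (e ∷ p) with prefix-∷ʳ⁻ ρ π p
... | inj₁ q       = inj₁ (e ∷ q)
... | inj₂ (q , d) = inj₂ (e ∷ q , d)

prefix-last-unique : ∀ (ρ σ : List (Hypergame ℓ)) {y z} → length ρ ≡ length σ →
                     Prefix _≅_ (ρ ++ [ y ]) π → Prefix _≅_ (σ ++ [ z ]) π → y ≅ z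
prefix-last-unique []      []      _  (e ∷ _) (d ∷ _) = ≅-trans e (≅-sym d)
prefix-last-unique (_ ∷ ρ) (_ ∷ σ) eq (_ ∷ p) (_ ∷ q) =
  prefix-last-unique ρ σ (suc-injective eq) p q

prefix-extend : Prefix _≅_ ρ π → Pointwise _≅_ ρ π ⊎ (∃[ z ] Prefix _≅_ (ρ ++ [ z ]) π)
prefix-extend {π = []}    []      = inj₁ []
prefix-extend {π = y ∷ _} []      = inj₂ (y , ≅-refl ∷ [])
prefix-extend             (e ∷ p) with prefix-extend p
... | inj₁ q       = inj₁ (e ∷ q)
... | inj₂ (z , q) = inj₂ (z , e ∷ q)

-- Finite plays

final-∷ʳ : ∀ (x : Hypergame ℓ) π {y} → final x (π ++ [ y ]) ≡ y
final-∷ʳ x []      = refl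
final-∷ʳ x (y ∷ π) = final-∷ʳ y π

final-cong : x ≅ y → Pointwise _≅_ ρ π → final x ρ ≅ final y π
final-cong e []      = e
final-cong _ (e ∷ p) = final-cong e p

play-∷ʳ⁺ : IsFinitePlay K x π → y ∈[ mover K (length π) ] final x π →
           IsFinitePlay K x (π ++ [ y ])
play-∷ʳ⁺ []      m = m ∷ []
play-∷ʳ⁺ (n ∷ p) m = n ∷ play-∷ʳ⁺ p m

play-∷ʳ⁻ : ∀ π → IsFinitePlay K x (π ++ [ y ]) →
           IsFinitePlay K x π × y ∈[ mover K (length π) ] final x π
play-∷ʳ⁻ []      (m ∷ []) = [] , m
play-∷ʳ⁻ (_ ∷ π) (n ∷ p)  = let q , m = play-∷ʳ⁻ π p in n ∷ q , m

play-prefix : x ≅ y → Prefix _≅_ ρ π → IsFinitePlay K x π → IsFinitePlay K y ρ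
play-prefix e []      _       = []
play-prefix e (d ∷ p) (m ∷ q) = ∈-respˡ d (∈-respʳ e m) ∷ play-prefix (≅-sym d) p q

play-applyUpTo : ∀ {s} → IsPlay K x (inf s) → ∀ n → IsFinitePlay K x (applyUpTo s n)
play-applyUpTo p zero      = []
play-applyUpTo p (ℕ.suc n) =
  p 0 ∷ play-applyUpTo (λ { zero → p 1 ; (ℕ.suc i) → p (ℕ.suc (ℕ.suc i)) }) n

-- Every play on x ends at a position of x.
locate : ∀ (x : Hypergame ℓ) {p} → y ≅ (x at p) → IsFinitePlay K y π →
         ∃[ q ] final y π ≅ (x at q)
locate x e []      = _ , e
locate x e (m ∷ p) = let _ , _ , f = ∈-respʳ e m in locate x f p

module _ {P : Role} {x : Hypergame ℓ} (π : FPlay P x) where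

  legal-move : y ∈[ player P ] final x (moves π) →
               IsFinitePlay (starter P) x (moves π ++ [ y ])
  legal-move m = play-∷ʳ⁺ (isPlay π) (subst (_ ∈[_] _) (sym (toMove π)) m)

  legal-move⁻ : IsFinitePlay (starter P) x (moves π ++ [ y ]) →
                y ∈[ player P ] final x (moves π)
  legal-move⁻ p = subst (_ ∈[_] _) (toMove π) (proj₂ (play-∷ʳ⁻ (moves π) p))

-- Coherence with a strategy

module _ {P : Role} {x : Hypergame ℓ} (f : Strategy P x) where

  -- Coherence of a finite play, phrased by the moves of P in it.
  Follows : List (Hypergame ℓ) → Set (suc ℓ)
  Follows π = ∀ ρ {y z} → Prefix _≅_ (moves ρ ++ [ z ]) π → next f ρ ≡ just y → y ≅ z

  coherent⇒follows : Coherent f (fin π) → Follows π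
  coherent⇒follows c ρ {z = z} p eq with c ρ
    (fin-fin (prefix-trans (prefix-∷ʳ (moves ρ)) p) ,
     λ { (fin-fin q) → ∷ʳ-not-prefix (prefix-trans p q) }) eq
  ... | fin-fin q = prefix-last-unique (moves ρ) (moves ρ) refl q p

  follows⇒coherent : Follows π → Coherent f (fin π)
  follows⇒coherent c ρ (fin-fin p , n) eq with prefix-extend p
  ... | inj₁ q       =
    contradiction (fin-fin (Prefix.fromPointwise (Pointwise.symmetric ≅-sym q))) n
  ... | inj₂ (z , q) = fin-fin
    (prefix-trans (Prefix.fromPointwise (∷ʳ-cong (moves ρ) (c ρ q eq))) q)

  follows-[] : Follows []
  follows-[] ρ p _ with moves ρ
  follows-[] ρ () _ | []
  follows-[] ρ () _ | _ ∷ _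

  follows-init : ∀ π {y} → Follows (π ++ [ y ]) → Follows π
  follows-init π c ρ p = c ρ (prefix-trans p (prefix-∷ʳ π))

  follows-own-move : ∀ ρ → Follows (moves ρ) → next f ρ ≡ just y →
                     Follows (moves ρ ++ [ y ])
  follows-own-move ρ c eq σ p eq′ with prefix-∷ʳ⁻ (moves σ) (moves ρ) p
  ... | inj₁ q       = c σ q eq′
  ... | inj₂ (q , e) = ≅-trans
    (Maybe.drop-just (subst₂ (Maybe.Pointwise _≅_) eq′ eq (next-cong f {σ} {ρ} q)))
    (≅-sym e)

  follows-opponent-move : mover (starter P) (length π) ≡ opp (player P) → Follows π →
                          Follows (π ++ [ y ])
  follows-opponent-move {π = π} t c σ p eq with prefix-∷ʳ⁻ (moves σ) π p
  ... | inj₁ q       = c σ q eq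
  ... | inj₂ (q , _) = ⊥-elim (opp-irreflexive (player P)
    (trans (sym (toMove σ)) (trans (cong (mover (starter P)) (Pointwise-length q)) t)))

  total-just : ∀ π → y ∈[ player P ] final x (moves π) → ∃[ z ] next f π ≡ just z
  total-just π m with next f π | total f π (legal-move π m)
  ... | just z | _ = z , refl

-- Strategies that aim at a goal

-- The goal G n is the class of hypergames into which the role P wants to make
-- the move number n, counted from 0 over the moves of both players. The
-- strategy reaches it whenever some legal move does, and else moves anywhere.
module Aiming (em : ExcludedMiddle (suc ℓ)) (choice : Choice ℓ (suc ℓ))
              (P : Role) (x : Hypergame ℓ)
              (G : ℕ → Pred (Hypergame ℓ) (suc ℓ))
              (G-resp : ∀ {n y z} → y ≅ z → G n y → G n z) where

  -- Positions are identified when they are equal as hypergames.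
  positions : Setoid ℓ (suc ℓ)
  positions = record
    { Carrier       = Pos x
    ; _≈_           = λ p q → (x at p) ≅ (x at q)
    ; isEquivalence = record { refl = ≅-refl ; sym = ≅-sym ; trans = ≅-trans }
    }

  rep : Pos x → Pos x
  rep = proj₁ (choice positions)

  rep-≅ : ∀ p → (x at rep p) ≅ (x at p)
  rep-≅ = proj₁ (proj₂ (choice positions))

  rep-cong : ∀ {p q} → (x at p) ≅ (x at q) → rep p ≡ rep q
  rep-cong = proj₂ (proj₂ (choice positions))

  -- q is an option of p, and it meets the goal if any option does.
  Best : ℕ → Pos x → Pos x → Set (suc ℓ)
  Best n p q = (x at q) ∈[ player P ] (x at p) ×
               (∀ {y} → y ∈[ player P ] (x at p) → G n y → G n (x at q))

  best-exists : ∀ {n p y} → y ∈[ player P ] (x at p) → ∃[ q ] Best n p q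
  best-exists {n} {p} {y} m
    with em {∃[ z ] z ∈[ player P ] (x at p) × G n z}
  ... | yes (z , (q , o , e) , g) = q , (q , o , ≅-refl) , λ _ _ → G-resp e g
  ... | no  none = let q , o , _ = m in
    q , (q , o , ≅-refl) , λ m′ g → contradiction (_ , m′ , g) none

  -- As a function of the decision, so that equal places yield the same move.
  move : ∀ {n p} → Dec (∃[ q ] Best n p q) → Maybe (Hypergame ℓ)
  move (yes (q , _)) = just (x at q)
  move (no _)        = nothing

  move-best : ∀ {n p} (d : Dec (∃[ q ] Best n p q)) {y} → move d ≡ just y →
              ∃[ q ] Best n p q × y ≡ (x at q)
  move-best (yes (q , b)) refl = q , b , refl

  move-total : ∀ {n p} (d : Dec (∃[ q ] Best n p q)) → ∃[ q ] Best n p q → Is-just (move d)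
  move-total (yes _) _ = just _
  move-total (no n)  b = contradiction b n

  -- The representative of the position at which a play ends.
  place : FPlay P x → Pos x
  place π = rep (proj₁ (locate x ≅-refl (isPlay π)))

  place-≅ : ∀ π → (x at place π) ≅ final x (moves π)
  place-≅ π = let p , e = locate x ≅-refl (isPlay π) in ≅-trans (rep-≅ p) (≅-sym e)

  place-cong : ∀ {π ρ} → Pointwise _≅_ (moves π) (moves ρ) → place π ≡ place ρ
  place-cong {π} {ρ} e = rep-cong
    (≅-trans (≅-sym (proj₂ (locate x ≅-refl (isPlay π))))
    (≅-trans (final-cong ≅-refl e) (proj₂ (locate x ≅-refl (isPlay ρ)))))

  aim : ℕ → Pos x → Maybe (Hypergame ℓ)
  aim n p = move {n} {p} em

  strategy : Strategy P x
  strategy .next π = aim (length (moves π)) (place π)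
  strategy .next-cong {π} {ρ} e = Maybe.reflexive (λ { refl → ≅-refl })
    (cong₂ aim (Pointwise-length e) (place-cong {π} {ρ} e))
  strategy .legal π eq with move-best em eq
  ... | _ , (m , _) , refl = legal-move π (∈-respʳ (place-≅ π) m)
  strategy .total π p =
    move-total em (best-exists (∈-respʳ (≅-sym (place-≅ π)) (legal-move⁻ π p)))

  strategy-aims : ∀ π {y z} → next strategy π ≡ just y →
                  z ∈[ player P ] final x (moves π) →
                  G (length (moves π)) z → G (length (moves π)) y
  strategy-aims π eq m g with move-best em eq
  ... | _ , (_ , best) , refl = best (∈-respʳ (≅-sym (place-≅ π)) m) g

-- Non-losing strategies and regions

module _ (em : ExcludedMiddle (suc ℓ)) (choice : Choice ℓ (suc ℓ))
         {P : Role} {x : Hypergame ℓ} (f : Strategy P x) where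

  -- If f had no answer, the opponent who aims at the play `moves φ` would make it
  -- the outcome, in which the player of f is stuck.
  respond : IsNonLosing f → ∀ π → Follows f (moves π) → ∃[ y ] next f π ≡ just y
  respond nl φ c with next f φ in eq
  ... | just y  = y , refl
  ... | nothing = ⊥-elim (refute (nl strategy _ outcome))
    where
    τ = moves φ

    no-move : ¬ y ∈[ player P ] final x τ
    no-move m with total-just f φ m
    ... | _ , eq′ with trans (sym eq) eq′
    ... | ()

    -- The goal of following τ: the move number n is the one made in τ.
    OnTrack : ℕ → Pred (Hypergame ℓ) (suc ℓ)
    OnTrack n y = ∃[ σ ] length σ ≡ n × Prefix _≅_ (σ ++ [ y ]) τ

    onTrack-resp : ∀ {n y z} → y ≅ z → OnTrack n y → OnTrack n z
    onTrack-resp e (σ , l , p) =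
      σ , l , prefix-trans (Prefix.fromPointwise (∷ʳ-cong σ (≅-sym e))) p

    open Aiming em choice (opponent P) x OnTrack onTrack-resp

    φ-play : IsFinitePlay (starter (opponent P)) x τ
    φ-play = subst (λ K → IsFinitePlay K x τ) (sym (starter-opponent P)) (isPlay φ)

    strategy-follows : Follows strategy τ
    strategy-follows ρ p eq′ with strategy-aims ρ eq′
      (legal-move⁻ ρ (play-prefix ≅-refl p φ-play)) (moves ρ , refl , p)
    ... | σ , l , q = prefix-last-unique σ (moves ρ) l q p

    not-extendable : ¬ IsFinitePlay (starter P) x (τ ++ [ y ])
    not-extendable p = no-move (legal-move⁻ φ p)

    outcome : Outcome f strategy (fin τ)
    outcome .Outcome.play      = isPlay φ
    outcome .Outcome.coherent  = follows⇒coherent f c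
    outcome .Outcome.coherent′ = follows⇒coherent strategy strategy-follows
    outcome .Outcome.maximal (fin ρ) p _ _ (fin-fin q) with prefix-extend q
    ... | inj₁ e        = fin-fin (Prefix.fromPointwise (Pointwise.symmetric ≅-sym e))
    ... | inj₂ (z , q′) = ⊥-elim (not-extendable (play-prefix ≅-refl q′ p))
    outcome .Outcome.maximal (inf s) p _ _ (fin-inf e) = ⊥-elim (not-extendable
      (play-prefix ≅-refl
        (Prefix.fromPointwise (subst (Pointwise _≅_ (τ ++ [ s n ])) (applyUpTo-∷ʳ s n)
          (Pointwise.++⁺ e (≅-refl ∷ []))))
        (play-applyUpTo p (ℕ.suc n))))
      where n = length τ

    refute : ¬ NonLosing (player P) (starter P) x (fin τ)
    refute (inj₁ (stuck t _)) = opp-irreflexive (player P) (trans (sym (toMove φ)) t)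

  nonLosing⇒safe : IsNonLosing f → Safe (player P) (starter P) x
  nonLosing⇒safe nl = Reached , region , first-move ,
                      λ t → [] , [] , follows-[] f , t , ≅-refl
    where
    -- The ends of the plays coherent with f in which the opponent is to move.
    Reached : Pred (Hypergame ℓ) (suc ℓ)
    Reached y = ∃[ π ] IsFinitePlay (starter P) x π × Follows f π ×
                mover (starter P) (length π) ≡ opp (player P) × final x π ≅ y

    answer : ∀ φ → Follows f (moves φ) → Reply (player P) Reached (final x (moves φ))
    answer φ c =
      let y , eq = respond nl φ c
          p      = legal f φ eq
      in  y , legal-move⁻ φ p ,
          moves φ ++ [ y ] , p , follows-own-move f φ c eq ,
          trans (cong (mover (starter P)) (length-∷ʳ (moves φ)))
            (trans (mover-suc (starter P) (length (moves φ))) (cong opp (toMove φ))) ,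
          subst (_≅ y) (sym (final-∷ʳ x (moves φ))) ≅-refl

    first-move : starter P ≡ player P → Reply (player P) Reached x
    first-move t = answer (record { moves = [] ; isPlay = [] ; toMove = t }) (follows-[] f)

    region : Region (player P) Reached
    region .resp e (π , p , c , t , d) = π , p , c , t , ≅-trans d e
    region .reply {y = y} (π , p , c , t , d) m =
      subst (Reply (player P) Reached) (final-∷ʳ x π)
        (answer record
          { moves  = π ++ [ y ]
          ; isPlay = play-∷ʳ⁺ p (subst (y ∈[_] _) (sym t) (∈-respʳ (≅-sym d) m))
          ; toMove = trans (cong (mover (starter P)) (length-∷ʳ π))
                       (trans (mover-suc (starter P) (length π))
                         (trans (cong opp t) (opp-involutive (player P))))
          } (follows-opponent-move f t c))

module _ (em : ExcludedMiddle (suc ℓ)) (choice : Choice ℓ (suc ℓ))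
         {P : Role} {x : Hypergame ℓ} where

  safe⇒nonLosing : Safe (player P) (starter P) x → Σ[ f ∈ Strategy P x ] IsNonLosing f
  safe⇒nonLosing (S , r , start) = strategy , nonLosing
    where
    goal-resp : ∀ {n : ℕ} {y z} → y ≅ z → S y → S z
    goal-resp = resp r

    open Aiming em choice P x (λ _ → S) (λ {n} → goal-resp {n})

    -- A play that follows the strategy stays alive, by induction from its end.
    alive : Reverse π → IsFinitePlay (starter P) x π → Follows strategy π →
            Alive (player P) S (mover (starter P) (length π)) (final x π)
    alive []                  _ _ = start
    alive (π ∶ reverse ∶ʳ y) p c =
      subst₂ (Alive (player P) S)
        (sym (trans (cong (mover (starter P)) (length-∷ʳ π)) (mover-suc (starter P) (length π))))
        (sym (final-∷ʳ x π))
        (step (same-or-opp (mover (starter P) (length π)) (player P)))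
      where
      q = proj₁ (play-∷ʳ⁻ π p)
      m = proj₂ (play-∷ʳ⁻ π p)

      before : Alive (player P) S (mover (starter P) (length π)) (final x π)
      before = alive reverse q (follows-init strategy π c)

      step : mover (starter P) (length π) ≡ player P ⊎
             mover (starter P) (length π) ≡ opp (player P) →
             Alive (player P) S (opp (mover (starter P) (length π))) y
      step (inj₁ t) =
        (λ k → ⊥-elim (opp-irreflexive (player P) (trans (sym k) (cong opp t)))) ,
        λ _ →
          let φ          = record { moves = π ; isPlay = q ; toMove = t }
              _ , o , s  = proj₁ before t
              _ , eq     = total-just strategy φ o
          in  resp r (c φ prefix-refl eq) (strategy-aims φ eq o s)
      step (inj₂ t) =
        (λ _ → reply r (proj₂ before t) (subst (y ∈[_] _) t m)) ,
        λ k → ⊥-elim (opp-irreflexive (player P)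
          (trans (trans (sym (opp-involutive (player P))) (cong opp (sym t))) k))

    nonLosing : IsNonLosing strategy
    nonLosing f′ (inf s) o = inj₂ infinite
    nonLosing f′ (fin π) o = conclude (same-or-opp (mover (starter P) (length π)) (player P))
      where
      open Outcome o

      c : Follows strategy π
      c = coherent⇒follows strategy coherent

      c′ : Follows f′ π
      c′ = coherent⇒follows f′ coherent′

      -- A finite outcome is maximal, so it ends where the player to move has no
      -- option; as the play is alive, this is the opponent.
      not-extendable : IsFinitePlay (starter P) x (π ++ [ y ]) →
                       Follows strategy (π ++ [ y ]) → ¬ Follows f′ (π ++ [ y ])
      not-extendable p d d′ with maximal (fin _) p (follows⇒coherent strategy d)
        (follows⇒coherent f′ d′) (fin-fin (prefix-∷ʳ π))
      ... | fin-fin q = ∷ʳ-not-prefix q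

      conclude : mover (starter P) (length π) ≡ player P ⊎
                 mover (starter P) (length π) ≡ opp (player P) →
                 NonLosing (player P) (starter P) x (fin π)
      conclude (inj₁ t) =
        let φ          = record { moves = π ; isPlay = play ; toMove = t }
            _ , m , _  = proj₁ (alive (reverseView π) play c) t
            _ , eq     = total-just strategy φ m
        in  ⊥-elim (not-extendable (legal strategy φ eq)
              (follows-own-move strategy φ c eq)
              (follows-opponent-move f′
                (trans (cong (λ K → mover K (length π)) (starter-opponent P))
                  (trans t (sym (trans (cong opp (player-opponent P))
                                       (opp-involutive (player P))))))
                c′))
      conclude (inj₂ t) = inj₁ (stuck t λ y m →
        let φ = record
              { moves  = π
              ; isPlay = subst (λ K → IsFinitePlay K x π) (sym (starter-opponent P)) play
              ; toMove = trans (cong (λ K → mover K (length π)) (starter-opponent P))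
                               (trans t (sym (player-opponent P)))
              }
            z , eq = total-just f′ φ (subst (y ∈[_] _) (sym (player-opponent P)) m)
        in  not-extendable
              (subst (λ K → IsFinitePlay K x (π ++ [ z ])) (starter-opponent P) (legal f′ φ eq))
              (follows-opponent-move strategy t c)
              (follows-own-move f′ φ c′ eq))

-- Contextual equivalence

Better-sides : (x y : Game ℓ) → x ∼ y → ∀ A → Better A (wellFounded x) (wellFounded y)
Better-sides x y (p , q) L = p
Better-sides x y (p , q) R = q

module _ (em : ExcludedMiddle (suc ℓ)) (choice : Choice ℓ (suc ℓ)) where

  transfer : {x y : Hypergame ℓ} → ∀ P →
             (Safe (player P) (starter P) x → Safe (player P) (starter P) y) →
             Σ[ f ∈ Strategy P x ] IsNonLosing f → Σ[ f ∈ Strategy P y ] IsNonLosing f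
  transfer P h (f , n) = safe⇒nonLosing em choice (h (nonLosing⇒safe em choice f n))

  ∼⇒HasNonLosing : (x y : Game ℓ) → x ∼ y → ∀ C S →
    HasNonLosing S (plug C (hypergame y)) → HasNonLosing S (plug C (hypergame x))
  ∼⇒HasNonLosing x y e C S ((f , g) , n , k) =
    let f′ , n′ = transfer (proj₁ (roles S)) improve (f , n)
        g′ , k′ = transfer (proj₂ (roles S)) improve (g , k)
    in  (f′ , g′) , n′ , k′
    where
    -- Here ∼ is used in both directions, one for each player.
    improve : Safe A K (plug C (hypergame y)) → Safe A K (plug C (hypergame x))
    improve {A = A} s = Safe-resp (≅-sym (plug-≅ C (hypergame x)))
      (Safe-improve {A = A} em (wellFounded x) (wellFounded y) (Better-sides x y e A)
        (Safe-resp (plug-≅ C (hypergame y)) s))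

  -- The context that adds the negation of x suffices, with the side II.
  ≈⇒∼ : (x y : Game ℓ) → hypergame x ≈ hypergame y → x ∼ y
  ≈⇒∼ x y e =
    let f₀ , n₀ = safe⇒nonLosing em choice {P = LII} (Safe-copycat L (hypergame x))
        g₀ , k₀ = safe⇒nonLosing em choice {P = RII} (Safe-copycat R (hypergame x))
        (f , g) , n , k =
          Equivalence.to (e (□ +ʳ neg (hypergame x)) II) ((f₀ , g₀) , n₀ , k₀)
    in  second-player (nonLosing⇒safe em choice g k) ,
        second-player (nonLosing⇒safe em choice f n)
    where
    second-player : Safe A (opp A) (hypergame y + neg (hypergame x)) →
                    Better A (wellFounded y) (wellFounded x)
    second-player (_ , r , _ , s) = difference-better r (wellFounded y) (wellFounded x) (s refl)

theorem4p4 : ∀ {ℓ} → ExcludedMiddle (suc ℓ) → Choice ℓ (suc ℓ) →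
    (x y : Game ℓ) → (hypergame x ≈ hypergame y) ⇔ (x ∼ y)
theorem4p4 em choice x y = mk⇔ (≈⇒∼ em choice x y) λ (p , q) C S →
  mk⇔ (∼⇒HasNonLosing em choice y x (q , p) C S) (∼⇒HasNonLosing em choice x y (p , q) C S)
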